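{- Let $T_n\subseteq{}^{\omega>}2$ (for $n<\omega$) be trees with no maximal nodes, $\bar{T}=\langle T_n:n<\omega\rangle$, $B=\bigcup_{n<\omega}\lim(T_n)$, and let $2\leq\iota<\omega$, $k=2\iota$. Let $\varepsilon\leq\omega_1$ be an ordinal and $\lambda$ an uncountable cardinal such that ${\rm Pr}_\varepsilon(\lambda)$ holds. If there is $A\subseteq{}^{\omega}2$ of cardinality $\lambda$ such that $|(B+\eta)\cap(B+\nu)|\geq k$ for all $\eta,\nu\in A$, then ${\rm NDRK}(\bar{T})\geq\varepsilon$.
   Context: ${}^{\omega>}2$ is the set of finite 0-1 sequences, ${}^{\ell}2$ those of length $\ell$; ${}^{\omega}2$ is the Cantor space; $+$ is coordinatewise addition modulo 2; $\nu\vartriangleleft\eta$ means that $\nu$ is a proper initial segment of $\eta$. For a tree $T\subseteq{}^{\omega>}2$, $\lim(T)$ is the set of its infinite branches in ${}^{\omega}2$. For a set $u$, $u^{\langle2\rangle}=\{(x,y)\in u\times u:x\neq y\}$. $\mathbf{M}_{\bar{T},k}$ consists of all tuples $\mathbf{m}=(\ell_{\mathbf{m}},u_{\mathbf{m}},\bar{h}_{\mathbf{m}},\bar{g}_{\mathbf{m}})=(\ell,u,\bar{h},\bar{g})$ such that: (i) $0<\ell<\omega$, $u\subseteq{}^{\ell}2$ and $2\leq|u|$; (ii) $\bar{h}=\langle h_i:i<\iota\rangle$, $\bar{g}=\langle g_i:i<\iota\rangle$, with $h_i:u^{\langle2\rangle}\to\omega$ and $g_i:u^{\langle2\rangle}\to\bigcup_{n<\omega}(T_n\cap{}^{\ell}2)$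 for each $i<\iota$; (iii) $g_i(\eta,\nu)\in T_{h_i(\eta,\nu)}\cap{}^{\ell}2$ for all $(\eta,\nu)\in u^{\langle2\rangle}$, $i<\iota$; (iv) $\eta+g_i(\eta,\nu)=\nu+g_i(\nu,\eta)$ for all $(\eta,\nu)\in u^{\langle2\rangle}$, $i<\iota$; (v) for any $(\eta,\nu)\in u^{\langle2\rangle}$ there are no repetitions in the sequence $\langle g_i(\eta,\nu),g_i(\nu,\eta):i<\iota\rangle$. The components of $\bar h_{\mathbf m},\bar g_{\mathbf m}$ are written $h^{\mathbf m}_i,g^{\mathbf m}_i$. Extension: $\mathbf{m}\sqsubseteq\mathbf{n}$ iff $\ell_{\mathbf{m}}\leq\ell_{\mathbf{n}}$, $u_{\mathbf{m}}=\{\eta\restriction\ell_{\mathbf{m}}:\eta\in u_{\mathbf{n}}\}$, and for every $(\eta,\nu)\in(u_{\mathbf{n}})^{\langle2\rangle}$ with $\eta\restriction\ell_{\mathbf{m}}\neq\nu\restriction\ell_{\mathbf{m}}$ and each $i<\iota$: $h^{\mathbf{m}}_i(\eta\restriction\ell_{\mathbf{m}},\nu\restriction\ell_{\mathbf{m}})=h^{\mathbf{n}}_i(\eta,\nu)$ and $g^{\mathbf{m}}_i(\eta\restriction\ell_{\mathbf{m}},\nu\restriction\ell_{\mathbf{m}})=g^{\mathbf{n}}_i(\eta,\nu)\restriction\ell_{\mathbf{m}}$. Rank ${\rm ndrk}:\mathbf{M}_{\bar{T},k}\to{\rm ON}\cup\{\infty\}$, defined by declaring inductively when ${\rm ndrk}(\mathbf{m})\geq\alpha$: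 ${\rm ndrk}(\mathbf{m})\geq0$ always; for limit $\alpha$, ${\rm ndrk}(\mathbf{m})\geq\alpha$ iff ${\rm ndrk}(\mathbf{m})\geq\beta$ for all $\beta<\alpha$; ${\rm ndrk}(\mathbf{m})\geq\beta+1$ iff for every $\nu\in u_{\mathbf{m}}$ there is $\mathbf{n}\in\mathbf{M}_{\bar{T},k}$ with $\ell_{\mathbf{n}}>\ell_{\mathbf{m}}$, $\mathbf{m}\sqsubseteq\mathbf{n}$, ${\rm ndrk}(\mathbf{n})\geq\beta$ and $|\{\eta\in u_{\mathbf{n}}:\nu\vartriangleleft\eta\}|\geq2$; ${\rm ndrk}(\mathbf{m})=\infty$ iff ${\rm ndrk}(\mathbf{m})\geq\alpha$ for all ordinals $\alpha$. ${\rm NDRK}(\bar{T})=\sup\{{\rm ndrk}(\mathbf{m})+1:\mathbf{m}\in\mathbf{M}_{\bar{T},k}\}$ (with $\infty+1=\infty$). Model rank. Let $\mathbb{M}$ be a model with universe a cardinal $\lambda$ and a countable vocabulary $\tau$. For finite non-empty $w=\{a_0,\ldots,a_n\}\subseteq\lambda$ with $|w|=n+1$, define ${\rm rk}(w,\mathbb{M})\geq\alpha$ by induction on ordinals $\alpha$: - ${\rm rk}(w,\mathbb{M})\geq 0$ iff for every quantifier free formula $\varphi\in\mathcal{L}(\tau)$ and each $j\leq n$, if $\mathbb{M}\models\varphi[a_0,\ldots,a_j,\ldots,a_n]$ then the set $\{a\in\lambda:\mathbb{M}\models\varphi[a_0,\ldots,a_{j-1},a,a_{j+1},\ldots,a_n]\}$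 is uncountable; - for limit $\alpha$, ${\rm rk}(w,\mathbb{M})\geq\alpha$ iff ${\rm rk}(w,\mathbb{M})\geq\beta$ for all $\beta<\alpha$; - ${\rm rk}(w,\mathbb{M})\geq\alpha+1$ iff for every quantifier free $\varphi\in\mathcal{L}(\tau)$ and each $j\leq n$, if $\mathbb{M}\models\varphi[a_0,\ldots,a_j,\ldots,a_n]$ then there is $a^*\in\lambda\setminus w$ with ${\rm rk}(w\cup\{a^*\},\mathbb{M})\geq\alpha$ and $\mathbb{M}\models\varphi[a_0,\ldots,a_{j-1},a^*,a_{j+1},\ldots,a_n]$. ${\rm rk}(w,\mathbb{M})=-1$ if not ${\rm rk}(w,\mathbb{M})\geq0$; $=\infty$ if ${\rm rk}(w,\mathbb{M})\geq\alpha$ for all $\alpha$; $=\alpha$ if ${\rm rk}(w,\mathbb{M})\geq\alpha$ but not $\geq\alpha+1$. ${\rm NPr}_{\varepsilon}(\lambda)$ says: there is a model $\mathbb{M}^*$ with universe $\lambda$ and a countable vocabulary such that $\sup\{{\rm rk}(w,\mathbb{M}^*):\emptyset\neq w\in[\lambda]^{<\omega}\}<\varepsilon$; ${\rm Pr}_\varepsilon(\lambda)$ is its negation. -}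

module Defs where

open import Level using (0ℓ)
open import Data.Bool.Base using (Bool; true; _xor_)
open import Data.Empty using (⊥)
open import Data.Fin.Base using (Fin; toℕ)
open import Data.Nat.Base as ℕ using (ℕ)
open import Data.Nat.Properties using (<⇒≤)
open import Data.Product.Base using (Σ; ∃; ∃-syntax; ∃₂; _×_; _,_; proj₁)
open import Data.Sum.Base using (_⊎_; [_,_]′)
open import Data.Unit.Base using (⊤)
open import Data.Vec.Base
  using (Vec; []; _∷_; lookup; tabulate; truncate; zipWith; _[_]≔_)
open import Data.Vec.Membership.Propositional using (_∉_)
open import Data.Vec.Relation.Unary.Unique.Propositional using (Unique)
open import Function.Base using (_∘_)
open import Function.Bundles using (Injection; _⇔_)
open import Function.Definitions using (Injective)
open import Relation.Binary.Bundles using (Setoid)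
open import Relation.Binary.Core using (Rel)
import Relation.Binary.Construct.Add.Extrema.NonStrict as Extrema≤
import Relation.Binary.Construct.Add.Extrema.Strict as Extrema<
import Relation.Binary.Construct.Add.Supremum.NonStrict as Supremum≤
import Relation.Binary.Construct.On as On
open import Relation.Binary.PropositionalEquality
  using (_≡_; _≢_; _≗_; setoid; _→-setoid_)
open import Relation.Nullary.Construct.Add.Extrema as Ext using (_±; ⊥±; ⊤±)
open import Relation.Nullary.Construct.Add.Supremum as Sup using (_⁺; ⊤⁺)
open import Relation.Nullary.Negation.Core using (¬_)
open import Relation.Unary using (Pred; _∈_; _∩_)

-- Elements of a subset are compared in the ambient setoid, so that
-- membership proofs are not counted.
subset : ∀ {c e p} (S : Setoid c e) → Pred (Setoid.Carrier S) p → Setoid _ _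
subset S P = On.setoid S (proj₁ {B = P})

infix 4 _≤∣_∣

_≤∣_∣ : ∀ {c e} → ℕ → Setoid c e → Set _
k ≤∣ S ∣ = Injection (setoid (Fin k)) S

-- Finite or countably infinite.
Countable : ∀ {c e} → Setoid c e → Set _
Countable S = Injection S (setoid ℕ)

Uncountable : ∀ {c e} → Setoid c e → Set _
Uncountable S = ¬ Countable S

-- Ordinals are presented as well-founded trees, where `lim I i₀ f` is the
-- supremum of the family f (inhabited, by i₀).  Distinct trees may denote
-- the same ordinal: α and β do so when α ≤ᵒ β and β ≤ᵒ α.  Every ordinal is
-- so denoted, each limit ordinal being the supremum of its predecessors.
data Ord : Set₁ where
  zero : Ord
  suc  : Ord → Ord
  lim  : (I : Set) → I → (I → Ord) → Ord

infix 4 _≤ᵒ_ _<ᵒ_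

_≤ᵒ_ : Rel Ord 0ℓ
_<ᵒ_ : Rel Ord 0ℓ

zero      ≤ᵒ β = ⊤
suc α     ≤ᵒ β = α <ᵒ β
lim I _ f ≤ᵒ β = ∀ i → f i ≤ᵒ β

α <ᵒ zero      = ⊥
α <ᵒ suc β     = α ≤ᵒ β
α <ᵒ lim I _ f = ∃[ i ] α <ᵒ f i

-- The countable ordinals: those generated from 0 by successors and
-- suprema of sequences.
data Brouwer : Set where
  zero : Brouwer
  suc  : Brouwer → Brouwer
  lim  : (ℕ → Brouwer) → Brouwer

⟦_⟧ : Brouwer → Ord
⟦ zero  ⟧ = zero
⟦ suc b ⟧ = suc ⟦ b ⟧
⟦ lim f ⟧ = lim ℕ 0 (λ n → ⟦ f n ⟧)

ω₁ : Ord
ω₁ = lim Brouwer zero ⟦_⟧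

-- Ord ⁺ is ON ∪ {∞} and Ord ± is {-1} ∪ ON ∪ {∞}.
open Supremum≤ _≤ᵒ_ public using (_≤⁺_)
open Extrema≤ _≤ᵒ_ public using (_≤±_)
open Extrema< _<ᵒ_ public using (_<±_)

suc⁺ : Ord ⁺ → Ord ⁺
suc⁺ Sup.[ α ] = Sup.[ suc α ]
suc⁺ ⊤⁺        = ⊤⁺

IsSup : ∀ {a ℓ p} {A : Set a} → Rel A ℓ → Pred A p → A → Set _
IsSup _≤_ S s = (∀ r → r ∈ S → r ≤ s) × (∀ t → (∀ r → r ∈ S → r ≤ t) → s ≤ t)

infixl 6 _⊕_ _+ᶜ_ _+ˢ_
infix 4 _◁_

_⊕_ : ∀ {ℓ} → Vec Bool ℓ → Vec Bool ℓ → Vec Bool ℓ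
_⊕_ = zipWith _xor_

_◁_ : ∀ {m n} → Vec Bool m → Vec Bool n → Set
_◁_ {m} {n} ν η = Σ (m ℕ.< n) λ m<n → truncate (<⇒≤ m<n) η ≡ ν

Cantor : Set
Cantor = ℕ → Bool

CantorSetoid : Setoid 0ℓ 0ℓ
CantorSetoid = ℕ →-setoid Bool

_↾_ : Cantor → (ℓ : ℕ) → Vec Bool ℓ
x ↾ ℓ = tabulate (x ∘ toℕ)

_+ᶜ_ : Cantor → Cantor → Cantor
(x +ᶜ y) n = x n xor y n

_+ˢ_ : Pred Cantor 0ℓ → Cantor → Pred Cantor 0ℓ
(X +ˢ η) y = ∃[ x ] x ∈ X × y ≗ x +ᶜ η

-- A set of finite sequences, given by its intersections with the levels.
SeqSet : Set₁
SeqSet = (ℓ : ℕ) → Pred (Vec Bool ℓ) 0ℓ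

IsTree : SeqSet → Set
IsTree T = ∀ {m n} {ν : Vec Bool m} {η : Vec Bool n} →
           η ∈ T n → ν ◁ η → ν ∈ T m

NoMaximalNodes : SeqSet → Set
NoMaximalNodes T = ∀ {m} {ν : Vec Bool m} → ν ∈ T m →
                   ∃₂ λ n (η : Vec Bool n) → η ∈ T n × ν ◁ η

branches : SeqSet → Pred Cantor 0ℓ
branches T x = ∀ ℓ → x ↾ ℓ ∈ T ℓ

⋃branches : (ℕ → SeqSet) → Pred Cantor 0ℓ
⋃branches T x = ∃[ n ] x ∈ branches (T n)

-- A subset of the finite set of sequences of length ℓ, given by its
-- characteristic function.
Level⊆ : ℕ → Set
Level⊆ ℓ = Vec Bool ℓ → Bool

infix 4 _∈ᵇ_

_∈ᵇ_ : ∀ {ℓ} → Vec Bool ℓ → Level⊆ ℓ → Set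
η ∈ᵇ u = u η ≡ true

_⟨2⟩ : ∀ {ℓ} → Level⊆ ℓ → Vec Bool ℓ → Vec Bool ℓ → Set
(u ⟨2⟩) η ν = η ∈ᵇ u × ν ∈ᵇ u × η ≢ ν

swap⟨2⟩ : ∀ {ℓ} {u : Level⊆ ℓ} {η ν} → (u ⟨2⟩) η ν → (u ⟨2⟩) ν η
swap⟨2⟩ (p , q , η≢ν) = q , p , λ { _≡_.refl → η≢ν _≡_.refl }

module _ (T : ℕ → SeqSet) (ι : ℕ) where

  -- The proof that a pair lies in u⟨2⟩ is irrelevant, so that h i and g i
  -- are functions of the pair alone.
  record 𝐌 : Set where
    field
      ℓ : ℕ
      u : Level⊆ ℓ
      h : Fin ι → (η ν : Vec Bool ℓ) → .((u ⟨2⟩) η ν) → ℕ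
      g : Fin ι → (η ν : Vec Bool ℓ) → .((u ⟨2⟩) η ν) → Vec Bool ℓ
      0<ℓ   : 0 ℕ.< ℓ
      2≤∣u∣ : 2 ≤∣ subset (setoid (Vec Bool ℓ)) (_∈ᵇ u) ∣
      g∈T   : ∀ i {η ν} (p : (u ⟨2⟩) η ν) → g i η ν p ∈ T (h i η ν p) ℓ
      g-sum : ∀ i {η ν} (p : (u ⟨2⟩) η ν) →
              η ⊕ g i η ν p ≡ ν ⊕ g i ν η (swap⟨2⟩ {u = u} p)
      g-inj : ∀ {η ν} (p : (u ⟨2⟩) η ν) →
              Injective {A = Fin ι ⊎ Fin ι} _≡_ _≡_
                [ (λ i → g i η ν p) , (λ i → g i ν η (swap⟨2⟩ {u = u} p)) ]′

module _ {T : ℕ → SeqSet} {ι : ℕ} where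

  open 𝐌

  infix 4 _⊑_

  -- In h-eq and g-eq, q says that the restrictions of η and ν are distinct;
  -- that they lie in u 𝐦 already follows from u-eq.
  record _⊑_ (𝐦 𝐧 : 𝐌 T ι) : Set where
    field
      ℓ≤   : ℓ 𝐦 ℕ.≤ ℓ 𝐧
      u-eq : ∀ σ → σ ∈ᵇ u 𝐦 ⇔ (∃[ η ] η ∈ᵇ u 𝐧 × truncate ℓ≤ η ≡ σ)
      h-eq : ∀ i {η ν} (p : (u 𝐧 ⟨2⟩) η ν)
             (q : (u 𝐦 ⟨2⟩) (truncate ℓ≤ η) (truncate ℓ≤ ν)) →
             h 𝐦 i (truncate ℓ≤ η) (truncate ℓ≤ ν) q ≡ h 𝐧 i η ν p
      g-eq : ∀ i {η ν} (p : (u 𝐧 ⟨2⟩) η ν)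
             (q : (u 𝐦 ⟨2⟩) (truncate ℓ≤ η) (truncate ℓ≤ ν)) →
             g 𝐦 i (truncate ℓ≤ η) (truncate ℓ≤ ν) q ≡ truncate ℓ≤ (g 𝐧 i η ν p)

  infix 4 _ndrk≥_ ndrk_≐_

  -- As `lim` is a supremum, its clause (here and in _rk≥_ below) covers
  -- limit ordinals; at suprema that are attained it adds nothing, since
  -- rank ≥ α is downward closed in α.
  _ndrk≥_ : 𝐌 T ι → Ord → Set
  𝐦 ndrk≥ zero      = ⊤
  𝐦 ndrk≥ suc β     = ∀ ν → ν ∈ᵇ u 𝐦 → ∃[ 𝐧 ]
    ℓ 𝐦 ℕ.< ℓ 𝐧 × 𝐦 ⊑ 𝐧 × 𝐧 ndrk≥ β ×
    2 ≤∣ subset (setoid (Vec Bool (ℓ 𝐧))) (λ η → η ∈ᵇ u 𝐧 × ν ◁ η) ∣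
  𝐦 ndrk≥ lim I _ f = ∀ i → 𝐦 ndrk≥ f i

  data ndrk_≐_ (𝐦 : 𝐌 T ι) : Ord ⁺ → Set₁ where
    ordinal  : ∀ {α} → 𝐦 ndrk≥ α → ¬ 𝐦 ndrk≥ suc α → ndrk 𝐦 ≐ Sup.[ α ]
    infinite : (∀ α → 𝐦 ndrk≥ α) → ndrk 𝐦 ≐ ⊤⁺

infix 4 NDRK_,_≐_ NDRK_,_≥_

NDRK_,_≐_ : (ℕ → SeqSet) → ℕ → Ord ⁺ → Set₁
NDRK T , ι ≐ s =
  IsSup _≤⁺_ (λ r → ∃₂ λ (𝐦 : 𝐌 T ι) r′ → ndrk 𝐦 ≐ r′ × r ≡ suc⁺ r′) s

NDRK_,_≥_ : (ℕ → SeqSet) → ℕ → Ord → Set₁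
NDRK T , ι ≥ ε = ∃[ s ] NDRK T , ι ≐ s × Sup.[ ε ] ≤⁺ s

record Vocabulary : Set₁ where
  field
    Fun Rl  : Set
    arityᶠ : Fun → ℕ
    arityʳ : Rl → ℕ

CountableVocabulary : Vocabulary → Set
CountableVocabulary τ = Countable (setoid Fun) × Countable (setoid Rl)
  where open Vocabulary τ

module _ (τ : Vocabulary) where

  open Vocabulary τ

  data Term (n : ℕ) : Set where
    var : Fin n → Term n
    app : (f : Fun) → Vec (Term n) (arityᶠ f) → Term n

  data QF (n : ℕ) : Set where
    _≐_     : Term n → Term n → QF n
    rel     : (R : Rl) → Vec (Term n) (arityʳ R) → QF n
    neg     : QF n → QF n
    _∧_ _∨_ : QF n → QF n → QF n

  record Model (Λ : Set) : Set₁ where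
    field
      funᴵ : (f : Fun) → Vec Λ (arityᶠ f) → Λ
      relᴵ : (R : Rl) → Pred (Vec Λ (arityʳ R)) 0ℓ

module _ {τ : Vocabulary} {Λ : Set} (𝕄 : Model τ Λ) where

  open Vocabulary τ
  open Model 𝕄

  eval  : ∀ {n} → Vec Λ n → Term τ n → Λ
  evals : ∀ {n k} → Vec Λ n → Vec (Term τ n) k → Vec Λ k
  eval  a (var i)    = lookup a i
  eval  a (app f ts) = funᴵ f (evals a ts)
  evals a []         = []
  evals a (t ∷ ts)   = eval a t ∷ evals a ts

  infix 4 ⊨_[_] _rk≥_ rk_≐_

  ⊨_[_] : ∀ {n} → QF τ n → Vec Λ n → Set
  ⊨ t₁ ≐ t₂ [ a ]  = eval a t₁ ≡ eval a t₂
  ⊨ rel R ts [ a ] = relᴵ R (evals a ts)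
  ⊨ neg φ [ a ]    = ¬ ⊨ φ [ a ]
  ⊨ φ ∧ ψ [ a ]    = ⊨ φ [ a ] × ⊨ ψ [ a ]
  ⊨ φ ∨ ψ [ a ]    = ⊨ φ [ a ] ⊎ ⊨ ψ [ a ]

  -- The finite set w of size n + 1 is given by an enumeration a without
  -- repetitions, and w ∪ {b} by b ∷ a.  As φ and j range over everything,
  -- the choice of the enumeration does not matter.
  _rk≥_ : ∀ {n} → Vec Λ (ℕ.suc n) → Ord → Set
  a rk≥ zero      = ∀ φ j → ⊨ φ [ a ] →
                    Uncountable (subset (setoid Λ) (λ b → ⊨ φ [ a [ j ]≔ b ]))
  a rk≥ suc α     = ∀ φ j → ⊨ φ [ a ] →
                    ∃[ b ] b ∉ a × (b ∷ a) rk≥ α × ⊨ φ [ a [ j ]≔ b ]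
  a rk≥ lim I _ f = ∀ i → a rk≥ f i

  data rk_≐_ {n} (a : Vec Λ (ℕ.suc n)) : Ord ± → Set₁ where
    minusOne : ¬ a rk≥ zero → rk a ≐ ⊥±
    ordinal  : ∀ {α} → a rk≥ α → ¬ a rk≥ suc α → rk a ≐ Ext.[ α ]
    infinite : (∀ α → a rk≥ α) → rk a ≐ ⊤±

NPr : Ord → Set → Set₁
NPr ε Λ = ∃₂ λ (τ : Vocabulary) (𝕄 : Model τ Λ) → CountableVocabulary τ ×
  ∃[ s ] IsSup _≤±_
           (λ r → ∃₂ λ n (a : Vec Λ (ℕ.suc n)) → Unique a × rk_≐_ 𝕄 a r) s
       × s <± Ext.[ ε ]

Pr : Ord → Set → Set₁
Pr ε Λ = ¬ NPr ε Λ

{-# OPTIONS --safe #-}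
-- Let η_a (a ∈ Λ) enumerate A.  For a ≠ b, half of the 2ι points of
-- (B + η_a) ∩ (B + η_b) provide g_i(a , b) ∈ lim T_{h_i(a , b)} satisfying the
-- analogues of (iii)-(v) for infinite sequences.  A finite set w ⊆ Λ with at
-- least two elements then yields, at every level ℓ high enough to separate
-- the finitely many sequences involved, some 𝐦 ∈ 𝐌 with u = {η_a ↾ ℓ : a ∈ w}.
-- Expand Λ by countably many relations for the bits of η_a and g_i(a , b) and
-- the values of h_i(a , b).  The quantifier-free type of w up to level ℓ is
-- given by a single formula, and the new point that the rank of w supplies for
-- it splits the node prescribed by ndrk; so rk w ≥ α implies ndrk 𝐦 ≥ α.  If
-- σ = NDRK < ε, then no 𝐦 has ndrk ≥ σ, hence no w has rk ≥ σ + 1, and the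
-- expansion witnesses NPr ε Λ.
module Submission where

open import Defs
open import Level using (0ℓ; lift; lower) renaming (suc to lsuc; Lift to ↑)
open import Axiom.ExcludedMiddle using (ExcludedMiddle)
open import Data.Bool.Base using (Bool; true; false; _xor_)
import Data.Bool.Properties as Bool
open import Data.Bool.Properties using (xor-assoc; xor-comm; xor-same; xor-identityʳ; ¬-not)
open import Data.Empty using (⊥)
open import Data.Fin.Base using (Fin; zero; suc; toℕ; fromℕ<; join; splitAt; punchIn)
open import Data.Fin.Properties as Fin using (toℕ<n; toℕ-fromℕ<; splitAt-join; punchIn-injective; punchInᵢ≢i)
open import Data.Maybe.Base using (Maybe; just; nothing)
open import Data.Nat.Base using (ℕ; zero; suc; _≤_; _<_; _*_; _+_; _⊔_; z≤n; s≤s)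
open import Data.Nat.DivMod using (_%_; [m+kn]%n≡m%n; m<n⇒m%n≡m)
open import Data.Nat.Properties as ℕ using (m≤m⊔n; m≤n⊔m; <⇒≤)
open import Data.Product.Base using (Σ; ∃; ∃-syntax; ∃₂; _×_; _,_; proj₁; proj₂)
open import Data.Sum.Base using (_⊎_; inj₁; inj₂; [_,_]′; swap)
open import Data.Sum.Properties using (swap-involutive; [,]-∘)
open import Data.Unit.Base using (tt)
open import Data.Vec.Base using (Vec; []; _∷_; lookup; truncate; _[_]≔_)
import Data.Vec.Membership.Propositional as Mem
open import Data.Vec.Membership.Propositional.Properties using (∈-lookup)
open import Data.Vec.Properties using (tabulate-cong; lookup∘tabulate; lookup∘update; lookup∘update′)
open import Data.Vec.Relation.Unary.Unique.Propositional using (Unique)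
open import Function.Base using (_∘_; id; case_of_)
open import Function.Bundles using (Bijection; Injection; mk⇔)
open import Function.Definitions using (Injective)
import Relation.Binary.Construct.Add.Supremum.NonStrict as Supremum≤
open Supremum≤ _≤ᵒ_ using (_≤⊤⁺; ≤⁺-trans) renaming ([_] to ⁺[_])
open import Relation.Binary.Construct.Add.Extrema.NonStrict _≤ᵒ_ using (⊥±≤_; _≤⊤±; ≤±-trans)
  renaming ([_] to ±[_])
open import Relation.Binary.Construct.Add.Extrema.Strict _<ᵒ_ using (<±-transʳ)
  renaming ([_] to <±[_])
open import Relation.Binary.Definitions using (tri<; tri≈; tri>)
open import Relation.Binary.PropositionalEquality
  using (_≡_; _≢_; _≗_; refl; sym; trans; cong; cong₂; subst; setoid; module ≡-Reasoning)
open import Relation.Nullary.Construct.Add.Extrema as Ext using (_±; ⊥±; ⊤±)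
open import Relation.Nullary.Construct.Add.Supremum as Sup using (_⁺; ⊤⁺)
open import Relation.Nullary.Decidable.Core using (Dec; yes; no; does; map′; decidable-stable)
open import Relation.Nullary.Decidable using (dec-true)
open import Relation.Nullary.Negation.Core using (¬_; contradiction)
open import Relation.Unary using (Pred; _∈_; _∩_)

-- Ordinals

≤ᵒ-lim : ∀ {I i₀ f} α {i} → α ≤ᵒ f i → α ≤ᵒ lim I i₀ f
≤ᵒ-lim zero        _ = tt
≤ᵒ-lim (suc α)     p = _ , p
≤ᵒ-lim (lim I _ f) p = λ i → ≤ᵒ-lim (f i) (p i)

≤ᵒ-refl : ∀ α → α ≤ᵒ α
≤ᵒ-refl zero        = tt
≤ᵒ-refl (suc α)     = ≤ᵒ-refl α
≤ᵒ-refl (lim I _ f) = λ i → ≤ᵒ-lim (f i) (≤ᵒ-refl (f i))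

≤-trans : ∀ α β γ → α ≤ᵒ β → β ≤ᵒ γ → α ≤ᵒ γ
<-≤-trans : ∀ α β γ → α <ᵒ β → β ≤ᵒ γ → α <ᵒ γ
≤-<-trans : ∀ α β γ → α ≤ᵒ β → β <ᵒ γ → α <ᵒ γ
≤-trans zero        β γ p q = tt
≤-trans (suc α)     β γ p q = <-≤-trans α β γ p q
≤-trans (lim I _ f) β γ p q = λ i → ≤-trans (f i) β γ (p i) q
<-≤-trans α (suc β)     γ p       q = ≤-<-trans α β γ p q
<-≤-trans α (lim I _ f) γ (i , p) q = <-≤-trans α (f i) γ p (q i)
≤-<-trans α β (suc γ)     p q       = ≤-trans α β γ p q
≤-<-trans α β (lim I _ f) p (i , q) = i , ≤-<-trans α β (f i) p q

<ᵒ-irrefl : ∀ α → ¬ α <ᵒ α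
<ᵒ-irrefl (suc α)        p       = <ᵒ-irrefl α p
<ᵒ-irrefl (lim I i₀ f) (i , p) =
  <ᵒ-irrefl (f i) (≤-<-trans (f i) (lim I i₀ f) (f i) (≤ᵒ-lim (f i) (≤ᵒ-refl (f i))) p)

-- Model ranks

module _ {τ : Vocabulary} where

  renameᵗ  : ∀ {m n} → (Fin m → Fin n) → Term τ m → Term τ n
  renameᵗˢ : ∀ {m n k} → (Fin m → Fin n) → Vec (Term τ m) k → Vec (Term τ n) k
  renameᵗ ρ (var i)    = var (ρ i)
  renameᵗ ρ (app f ts) = app f (renameᵗˢ ρ ts)
  renameᵗˢ ρ []        = []
  renameᵗˢ ρ (t ∷ ts)  = renameᵗ ρ t ∷ renameᵗˢ ρ ts

  rename : ∀ {m n} → (Fin m → Fin n) → QF τ m → QF τ n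
  rename ρ (t₁ ≐ t₂)  = renameᵗ ρ t₁ ≐ renameᵗ ρ t₂
  rename ρ (rel R ts) = rel R (renameᵗˢ ρ ts)
  rename ρ (neg φ)    = neg (rename ρ φ)
  rename ρ (φ ∧ ψ)    = rename ρ φ ∧ rename ρ ψ
  rename ρ (φ ∨ ψ)    = rename ρ φ ∨ rename ρ ψ

  module _ {Λ : Set} (𝕄 : Model τ Λ) where

    open Model 𝕄

    module _ {m n} {ρ : Fin m → Fin n} {a : Vec Λ m} {b : Vec Λ n}
             (b∘ρ≗a : lookup b ∘ ρ ≗ lookup a) where

      eval-rename  : ∀ t → eval 𝕄 b (renameᵗ ρ t) ≡ eval 𝕄 a t
      evals-rename : ∀ {k} (ts : Vec _ k) → evals 𝕄 b (renameᵗˢ ρ ts) ≡ evals 𝕄 a ts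
      eval-rename (var i)    = b∘ρ≗a i
      eval-rename (app f ts) = cong (funᴵ f) (evals-rename ts)
      evals-rename []        = refl
      evals-rename (t ∷ ts)  = cong₂ _∷_ (eval-rename t) (evals-rename ts)

      ⊨-rename : ∀ φ → ⊨_[_] 𝕄 (rename ρ φ) b ≡ ⊨_[_] 𝕄 φ a
      ⊨-rename (t₁ ≐ t₂)  = cong₂ _≡_ (eval-rename t₁) (eval-rename t₂)
      ⊨-rename (rel R ts) = cong (relᴵ R) (evals-rename ts)
      ⊨-rename (neg φ)    = cong ¬_ (⊨-rename φ)
      ⊨-rename (φ ∧ ψ)    = cong₂ _×_ (⊨-rename φ) (⊨-rename ψ)
      ⊨-rename (φ ∨ ψ)    = cong₂ _⊎_ (⊨-rename φ) (⊨-rename ψ)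

    substitute₀ : ∀ {n} → Fin n → Fin n → Fin (suc n)
    substitute₀ j i with i Fin.≟ j
    ... | yes _ = zero
    ... | no  _ = suc i

    lookup-substitute₀ : ∀ {n} j (a : Vec Λ n) c →
                         lookup (c ∷ a) ∘ substitute₀ j ≗ lookup (a [ j ]≔ c)
    lookup-substitute₀ j a c i with i Fin.≟ j
    ... | yes refl = sym (lookup∘update i a c)
    ... | no  i≢j  = sym (lookup∘update′ i≢j a c)

    -- A witness b for a rk≥ 1 satisfies, in w ∪ {b}, the formula φ with the
    -- variable of a_j replaced by that of b, so rank ≥ 0 of w ∪ {b} yields
    -- uncountably many further witnesses.
    rk≥⇒rk≥0 : ∀ α {n} (a : Vec Λ (suc n)) → _rk≥_ 𝕄 a α → _rk≥_ 𝕄 a zero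
    rk≥⇒rk≥0 zero         a p = p
    rk≥⇒rk≥0 (lim I i₀ f) a p = rk≥⇒rk≥0 (f i₀) a (p i₀)
    rk≥⇒rk≥0 (suc α)      a p φ j ⊨φ countable =
      let b , _ , q , ⊨φb = p φ j ⊨φ
          module C = Injection countable
      in rk≥⇒rk≥0 α (b ∷ a) q (rename (substitute₀ j) φ) zero
           (subst id (sym (⊨-rename (lookup-substitute₀ j a b) φ)) ⊨φb)
           record
             { to        = λ (c , ⊨c) → C.to (c , subst id (⊨-rename (lookup-substitute₀ j a c) φ) ⊨c)
             ; cong      = C.cong
             ; injective = C.injective
             }

    rk≥-antimono : ∀ α β {n} (a : Vec Λ (suc n)) → α ≤ᵒ β → _rk≥_ 𝕄 a β → _rk≥_ 𝕄 a α
    rk≥-antimono zero    β a _ q = rk≥⇒rk≥0 β a q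
    rk≥-antimono (lim I _ f) β a p q = λ i → rk≥-antimono (f i) β a (p i) q
    rk≥-antimono (suc α) (suc β) a p q = λ φ j ⊨φ →
      let b , b∉a , r , ⊨φb = q φ j ⊨φ
      in b , b∉a , rk≥-antimono α β (b ∷ a) p r , ⊨φb
    rk≥-antimono (suc α) (lim I _ f) a (i , p) q = rk≥-antimono (suc α) (f i) a p (q i)

module _ {T : ℕ → SeqSet} {ι : ℕ} where

  ndrk≥-antimono : ∀ α β {𝐦 : 𝐌 T ι} → α ≤ᵒ β → 𝐦 ndrk≥ β → 𝐦 ndrk≥ α
  ndrk≥-antimono zero    β _ q = tt
  ndrk≥-antimono (lim I _ f) β p q = λ i → ndrk≥-antimono (f i) β (p i) q
  ndrk≥-antimono (suc α) (suc β) p q = λ ν ν∈u →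
    let 𝐧 , ℓ< , 𝐦⊑𝐧 , r , two = q ν ν∈u
    in 𝐧 , ℓ< , 𝐦⊑𝐧 , ndrk≥-antimono α β p r , two
  ndrk≥-antimono (suc α) (lim I _ f) (i , p) q = ndrk≥-antimono (suc α) (f i) p (q i)

module Classical (em : ExcludedMiddle (lsuc 0ℓ)) where

  abstract
    dec : (P : Set) → Dec P
    dec P = map′ lower lift (em {↑ (lsuc 0ℓ) P})

  ∃¬⊎∀ : {I : Set} (P : I → Set) → ∃ (λ i → ¬ P i) ⊎ (∀ i → P i)
  ∃¬⊎∀ P with dec (∃ λ i → ¬ P i)
  ... | yes p = inj₁ p
  ... | no  p = inj₂ λ i → decidable-stable (dec (P i)) λ ¬Pi → p (i , ¬Pi)

  ≤ᵒ-or-> : ∀ α β → α ≤ᵒ β ⊎ β <ᵒ α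
  ≤ᵒ-or-> zero        β    = inj₁ tt
  ≤ᵒ-or-> (lim I _ f) β    with ∃¬⊎∀ (λ i → f i ≤ᵒ β)
  ... | inj₂ f≤β         = inj₁ f≤β
  ... | inj₁ (i , fi≰β) with ≤ᵒ-or-> (f i) β
  ...   | inj₁ fi≤β = contradiction fi≤β fi≰β
  ...   | inj₂ β<fi = inj₂ (i , β<fi)
  ≤ᵒ-or-> (suc α) zero     = inj₂ tt
  ≤ᵒ-or-> (suc α) (suc β)  = ≤ᵒ-or-> α β
  ≤ᵒ-or-> (suc α) (lim I i₀ g) with dec (∃[ i ] α <ᵒ g i)
  ... | yes α<g = inj₁ α<g
  ... | no  α≮g = inj₂ λ i → case ≤ᵒ-or-> (suc α) (g i) of λ where
    (inj₁ α<gi) → contradiction (i , α<gi) α≮g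
    (inj₂ gi≤α) → gi≤α

  lastRank : (R : Ord → Set) → R zero →
             (∀ {I i₀ f} → (∀ i → R (f i)) → R (lim I i₀ f)) →
             ∀ α → ¬ R α → ∃[ β ] R β × ¬ R (suc β)
  lastRank R R0 Rlim zero    ¬Rα = contradiction R0 ¬Rα
  lastRank R R0 Rlim (suc α) ¬Rα with dec (R α)
  ... | yes Rα  = α , Rα , ¬Rα
  ... | no  ¬Rα′ = lastRank R R0 Rlim α ¬Rα′
  lastRank R R0 Rlim (lim I i₀ f) ¬Rα with ∃¬⊎∀ (R ∘ f)
  ... | inj₁ (i , ¬Rfi) = lastRank R R0 Rlim (f i) ¬Rfi
  ... | inj₂ Rf         = contradiction (Rlim Rf) ¬Rα

  ndrk-exists : ∀ {T ι} (𝐦 : 𝐌 T ι) → ∃[ r ] ndrk 𝐦 ≐ r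
  ndrk-exists 𝐦 with em {∃[ α ] ¬ 𝐦 ndrk≥ α}
  ... | no p = ⊤⁺ , infinite λ α → decidable-stable (dec _) λ ¬r → p (α , ¬r)
  ... | yes (α , ¬r) =
    let β , q , ¬q = lastRank (𝐦 ndrk≥_) tt id α ¬r
    in Sup.[ β ] , ordinal q ¬q

  rk-exists : ∀ {τ Λ} (𝕄 : Model τ Λ) {n} (a : Vec Λ (suc n)) → ∃[ r ] rk_≐_ 𝕄 a r
  rk-exists 𝕄 a with dec (_rk≥_ 𝕄 a zero)
  ... | no ¬p = ⊥± , minusOne ¬p
  ... | yes p with em {∃[ α ] ¬ _rk≥_ 𝕄 a α}
  ...   | no q = ⊤± , infinite λ α → decidable-stable (dec _) λ ¬r → q (α , ¬r)
  ...   | yes (α , ¬r) =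
    let β , q , ¬q = lastRank (_rk≥_ 𝕄 a) p id α ¬r
    in Ext.[ β ] , ordinal q ¬q

  ndrk-unique : ∀ {T ι} {𝐦 : 𝐌 T ι} {r r′} → ndrk 𝐦 ≐ r → ndrk 𝐦 ≐ r′ → suc⁺ r ≤⁺ suc⁺ r′
  ndrk-unique p              (infinite _) = _ ≤⊤⁺
  ndrk-unique (infinite p)   (ordinal {β} _ ¬q) = contradiction (p (suc β)) ¬q
  ndrk-unique (ordinal {α} p _) (ordinal {β} _ ¬q) with ≤ᵒ-or-> α β
  ... | inj₁ α≤β = ⁺[ α≤β ]
  ... | inj₂ β<α = contradiction (ndrk≥-antimono (suc β) α β<α p) ¬q

  rk-unique : ∀ {τ Λ} {𝕄 : Model τ Λ} {n} {a : Vec Λ (suc n)} {r r′} →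
              rk_≐_ 𝕄 a r → rk_≐_ 𝕄 a r′ → r ≤± r′
  rk-unique (minusOne _)   _              = ⊥±≤ _
  rk-unique _              (infinite _)   = _ ≤⊤±
  rk-unique (infinite p)   (minusOne ¬q)  = contradiction (p zero) ¬q
  rk-unique (infinite p)   (ordinal {β} _ ¬q) = contradiction (p (suc β)) ¬q
  rk-unique {𝕄 = 𝕄} {a = a} (ordinal {α} p _) (minusOne ¬q)     =
    contradiction (rk≥⇒rk≥0 𝕄 α a p) ¬q
  rk-unique {𝕄 = 𝕄} {a = a} (ordinal {α} p _) (ordinal {β} _ ¬q) with ≤ᵒ-or-> α β
  ... | inj₁ α≤β = ±[ α≤β ]
  ... | inj₂ β<α = contradiction (rk≥-antimono 𝕄 (suc β) α a β<α p) ¬q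

  finitePart⁺ : Ord ⁺ → Ord
  finitePart⁺ Sup.[ α ] = α
  finitePart⁺ ⊤⁺        = zero

  finitePart : Ord ± → Ord
  finitePart Ext.[ α ] = α
  finitePart _         = zero

  sup⁺ : {I : Set} (v : I → Ord ⁺) →
         ∃[ s ] (∀ i → v i ≤⁺ s) × (∀ t → (∀ i → v i ≤⁺ t) → s ≤⁺ t)
  sup⁺ {I} v with em {∃[ i ] v i ≡ ⊤⁺} | dec I
  ... | yes (i , vi≡⊤) | _ = ⊤⁺ , (λ i → _ ≤⊤⁺) , λ t ub → subst (_≤⁺ t) vi≡⊤ (ub i)
  ... | no _ | no ¬i = Sup.[ zero ] , (λ i → contradiction i ¬i) , λ where
    Sup.[ τ ] _ → ⁺[ tt ]
    ⊤⁺        _ → _ ≤⊤⁺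
  ... | no v≢⊤ | yes i₀ = Sup.[ lim I i₀ (finitePart⁺ ∘ v) ] , upper , least
    where
    upper : ∀ i → v i ≤⁺ Sup.[ lim I i₀ (finitePart⁺ ∘ v) ]
    upper i with v i in vi≡
    ... | ⊤⁺        = contradiction (i , vi≡) v≢⊤
    ... | Sup.[ α ] = ⁺[ ≤ᵒ-lim α (subst (λ r → α ≤ᵒ finitePart⁺ r) (sym vi≡) (≤ᵒ-refl α)) ]
    below : ∀ {r τ} → r ≤⁺ Sup.[ τ ] → finitePart⁺ r ≤ᵒ τ
    below ⁺[ p ] = p
    least : ∀ t → (∀ i → v i ≤⁺ t) → Sup.[ lim I i₀ (finitePart⁺ ∘ v) ] ≤⁺ t
    least ⊤⁺        _  = _ ≤⊤⁺
    least Sup.[ τ ] ub = ⁺[ (λ i → below (ub i)) ]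

  sup± : {I : Set} (v : I → Ord ±) →
         ∃[ s ] (∀ i → v i ≤± s) × (∀ t → (∀ i → v i ≤± t) → s ≤± t)
  sup± {I} v with em {∃[ i ] v i ≡ ⊤±} | em {∃₂ λ i α → v i ≡ Ext.[ α ]}
  ... | yes (i , vi≡⊤) | _ = ⊤± , (λ i → _ ≤⊤±) , λ t ub → subst (_≤± t) vi≡⊤ (ub i)
  ... | no v≢⊤ | no v≢ord = ⊥± , upper , λ t _ → ⊥±≤ t
    where
    upper : ∀ i → v i ≤± ⊥±
    upper i with v i in vi≡
    ... | ⊤±        = contradiction (i , vi≡) v≢⊤
    ... | ⊥±        = ⊥±≤ ⊥±
    ... | Ext.[ α ] = contradiction (i , α , vi≡) v≢ord
  ... | no v≢⊤ | yes (i₀ , α₀ , vi₀≡) = Ext.[ lim I i₀ (finitePart ∘ v) ] , upper , least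
    where
    upper : ∀ i → v i ≤± Ext.[ lim I i₀ (finitePart ∘ v) ]
    upper i with v i in vi≡
    ... | ⊤±        = contradiction (i , vi≡) v≢⊤
    ... | ⊥±        = ⊥±≤ _
    ... | Ext.[ α ] = ±[ ≤ᵒ-lim α (subst (λ r → α ≤ᵒ finitePart r) (sym vi≡) (≤ᵒ-refl α)) ]
    below : ∀ {r τ} → r ≤± Ext.[ τ ] → finitePart r ≤ᵒ τ
    below {⊥±}        _      = tt
    below {Ext.[ α ]} ±[ p ] = p
    least : ∀ t → (∀ i → v i ≤± t) → Ext.[ lim I i₀ (finitePart ∘ v) ] ≤± t
    least ⊤±        _  = _ ≤⊤±
    least ⊥±        ub with Supremum≤.[ () ] ← subst (_≤± ⊥±) vi₀≡ (ub i₀)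
    least Ext.[ τ ] ub = ±[ (λ i → below {v i} (ub i)) ]

  NDRK-exists : ∀ T ι → ∃[ s ] NDRK T , ι ≐ s
  NDRK-exists T ι =
    let s , upper , least = sup⁺ (λ (𝐦 : 𝐌 T ι) → suc⁺ (proj₁ (ndrk-exists 𝐦)))
    in s
     , (λ { _ (𝐦 , r , p , refl) →
            ≤⁺-trans (λ {α} {β} {γ} → ≤-trans α β γ)
              (ndrk-unique p (proj₂ (ndrk-exists 𝐦))) (upper 𝐦) })
     , λ t ub → least t λ 𝐦 → ub _ (𝐦 , _ , proj₂ (ndrk-exists 𝐦) , refl)

-- Overlapping translations

xor-cancelʳ : ∀ a x → (a xor x) xor x ≡ a
xor-cancelʳ a x = trans (xor-assoc a x x) (trans (cong (a xor_) (xor-same x)) (xor-identityʳ a))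

xor-cancelˡ : ∀ a x → a xor (a xor x) ≡ x
xor-cancelˡ a x = trans (sym (xor-assoc a a x)) (cong (_xor x) (xor-same a))

xor-rightComm : ∀ a x y → (a xor x) xor y ≡ (a xor y) xor x
xor-rightComm a x y =
  trans (xor-assoc a x y) (trans (cong (a xor_) (xor-comm x y)) (sym (xor-assoc a y x)))

record Overlap (T : ℕ → SeqSet) {ι : ℕ} (x y : Cantor) (f f′ : Fin ι → ℕ × Cantor) : Set where
  field
    shift∈    : ∀ i → proj₂ (f i) ∈ branches (T (proj₁ (f i)))
    shift′∈   : ∀ i → proj₂ (f′ i) ∈ branches (T (proj₁ (f′ i)))
    shift-sum : ∀ i → x +ᶜ proj₂ (f i) ≗ y +ᶜ proj₂ (f′ i)
    shift-inj : Injective {A = Fin ι ⊎ Fin ι} _≡_ _≗_ [ proj₂ ∘ f , proj₂ ∘ f′ ]′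

flip : ∀ {T ι x y} {f f′ : Fin ι → ℕ × Cantor} → Overlap T x y f f′ → Overlap T y x f′ f
flip {ι = ι} {f = f} {f′} o = record
  { shift∈    = shift′∈
  ; shift′∈   = shift∈
  ; shift-sum = λ i n → sym (shift-sum i n)
  ; shift-inj = λ {s} {t} eq →
      swap-injective (shift-inj λ n → trans (swapped s n) (trans (eq n) (sym (swapped t n))))
  }
  where
  open Overlap o
  swap-injective : {s t : Fin ι ⊎ Fin ι} → swap s ≡ swap t → s ≡ t
  swap-injective {s} {t} eq =
    trans (sym (swap-involutive s)) (trans (cong swap eq) (swap-involutive t))
  swapped : ∀ s n → [ proj₂ ∘ f , proj₂ ∘ f′ ]′ (swap s) n ≡ [ proj₂ ∘ f′ , proj₂ ∘ f ]′ s n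
  swapped (inj₁ _) n = refl
  swapped (inj₂ _) n = refl

Precedes : Cantor → Cantor → Set
Precedes x y = ∃[ n ] (∀ m → m < n → x m ≡ y m) × x n ≡ false × y n ≡ true

Precedes-asym : ∀ {x y} → Precedes x y → ¬ Precedes y x
Precedes-asym (m , x≡y , xm , ym) (n , y≡x , yn , xn) with ℕ.<-cmp m n
... | tri< m<n _ _  = contradiction (trans (sym ym) (trans (y≡x m m<n) xm)) λ ()
... | tri≈ _ refl _ = contradiction (trans (sym xn) xm) λ ()
... | tri> _ _ n<m  = contradiction (trans (sym xn) (trans (x≡y n n<m) yn)) λ ()

module Choice (em : ExcludedMiddle (lsuc 0ℓ)) where

  open Classical em

  difference : ∀ {x y : Cantor} → ¬ x ≗ y → ∃[ n ] x n ≢ y n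
  difference {x} {y} x≢y with ∃¬⊎∀ (λ n → x n ≡ y n)
  ... | inj₁ d   = d
  ... | inj₂ x≗y = contradiction x≗y x≢y

  leastDifference : ∀ (x y : Cantor) n → x n ≢ y n →
                    ∃[ k ] (∀ m → m < k → x m ≡ y m) × x k ≢ y k
  leastDifference x y n xn≢yn = [ (λ x≡y → n , x≡y , xn≢yn) , id ]′ (search n)
    where
    search : ∀ n → (∀ m → m < n → x m ≡ y m) ⊎ ∃[ k ] (∀ m → m < k → x m ≡ y m) × x k ≢ y k
    search zero    = inj₁ λ _ ()
    search (suc n) with search n | x n Bool.≟ y n
    ... | inj₂ found | _         = inj₂ found
    ... | inj₁ x≡y   | no xn≢yn  = inj₂ (n , x≡y , xn≢yn)
    ... | inj₁ x≡y   | yes xn≡yn = inj₁ λ m m<1+n →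
      case ℕ.m≤n⇒m<n∨m≡n (ℕ.≤-pred m<1+n) of λ where
        (inj₁ m<n)  → x≡y m m<n
        (inj₂ refl) → xn≡yn

  Precedes-total : ∀ {x y} → ¬ x ≗ y → Precedes x y ⊎ Precedes y x
  Precedes-total {x} {y} x≢y with n , x≢y ← difference x≢y
    with k , x≡y , xk≢yk ← leastDifference x y n x≢y
    with x k in xk | y k in yk
  ... | false | true  = inj₁ (k , x≡y , xk , yk)
  ... | true  | false = inj₂ (k , (λ m m<k → sym (x≡y m m<k)) , yk , xk)
  ... | false | false = contradiction refl xk≢yk
  ... | true  | true  = contradiction refl xk≢yk

  -- Greedily: choosing a vertex discards at most its one neighbour.
  independent : {X : Set} (_~_ : X → X → Set) →
                (∀ {x y} → x ~ y → y ~ x) → (∀ {x} → ¬ x ~ x) →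
                (∀ {x y z} → x ~ y → x ~ z → y ≡ z) →
                ∀ n {m} → n * 2 ≤ m → (f : Fin m → X) → Injective _≡_ _≡_ f →
                ∃[ q ] Injective {A = Fin n} {B = X} _≡_ _≡_ q ×
                  (∀ i j → ¬ q i ~ q j) × (∀ i → ∃[ k ] q i ≡ f k)
  independent _~_ ~-sym ~-irrefl ~-unique zero    _ f f-inj =
    (λ ()) , (λ { {()} }) , (λ ()) , λ ()
  independent {X} _~_ ~-sym ~-irrefl ~-unique (suc n) {suc (suc m)} (s≤s (s≤s n*2≤m)) f f-inj =
    q′ , q′-inj , q′-indep , q′-range
    where
    partner : ∃[ k ] ∀ l → f zero ~ f (suc l) → l ≡ k
    partner with dec (∃[ k ] f zero ~ f (suc k))
    ... | yes (k , p) = k , λ l q → Fin.suc-injective (f-inj (~-unique q p))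
    ... | no  p       = zero , λ l q → contradiction (l , q) p
    k = proj₁ partner
    ρ : Fin m → Fin (suc (suc m))
    ρ i = suc (punchIn k i)
    rest = independent _~_ ~-sym ~-irrefl ~-unique n n*2≤m (f ∘ ρ)
      (punchIn-injective k _ _ ∘ Fin.suc-injective ∘ f-inj)
    q = proj₁ rest
    q-inj = proj₁ (proj₂ rest)
    q-indep = proj₁ (proj₂ (proj₂ rest))
    q-range = proj₂ (proj₂ (proj₂ rest))
    f0≁q : ∀ i → ¬ f zero ~ q i
    f0≁q i p with l , qi≡ ← q-range i =
      punchInᵢ≢i k l (proj₂ partner (punchIn k l) (subst (f zero ~_) qi≡ p))
    f0≢q : ∀ i → f zero ≢ q i
    f0≢q i eq with l , qi≡ ← q-range i with () ← f-inj (trans eq qi≡)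
    q′ : Fin (suc n) → X
    q′ zero    = f zero
    q′ (suc i) = q i
    q′-inj : Injective _≡_ _≡_ q′
    q′-inj {zero}  {zero}  _  = refl
    q′-inj {zero}  {suc j} eq = contradiction eq (f0≢q j)
    q′-inj {suc i} {zero}  eq = contradiction (sym eq) (f0≢q i)
    q′-inj {suc i} {suc j} eq = cong suc (q-inj eq)
    q′-indep : ∀ i j → ¬ q′ i ~ q′ j
    q′-indep zero    zero    = ~-irrefl
    q′-indep zero    (suc j) = f0≁q j
    q′-indep (suc i) zero    = f0≁q i ∘ ~-sym
    q′-indep (suc i) (suc j) = q-indep i j
    q′-range : ∀ i → ∃[ l ] q′ i ≡ f l
    q′-range zero    = zero , refl
    q′-range (suc i) = let l , eq = q-range i in ρ l , eq

  module _ {T : ℕ → SeqSet} {ι : ℕ} where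

    -- A point z of (B + x) ∩ (B + y) gives the pair (z + x , z + y) of points
    -- of B.  The pairs of two points s and t meet only if their first and
    -- second coordinates are exchanged, which joins each s to at most one t:
    -- half of the 2ι points have disjoint pairs.
    translates-overlap : ∀ {x y} → ¬ x ≗ y →
              2 * ι ≤∣ subset CantorSetoid ((⋃branches T +ˢ x) ∩ (⋃branches T +ˢ y)) ∣ →
              ∃₂ λ (f f′ : Fin ι → ℕ × Cantor) → Overlap T x y f f′
    translates-overlap {x} {y} x≢y points = height×b ∘ q , height×b′ ∘ q , record
      { shift∈ = λ i → proj₂ (proj₁ (proj₂ (proj₁ (proj₂ (P.to (q i))))))
      ; shift′∈ = λ i → proj₂ (proj₁ (proj₂ (proj₂ (proj₂ (P.to (q i))))))
      ; shift-sum = λ i n →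
          trans (xor-comm (x n) _) (trans (b+x≡b′+y (q i) n) (xor-comm _ (y n)))
      ; shift-inj = shift-inj
      }
      where
      module P = Injection points
      z b b′ : Fin (2 * ι) → Cantor
      z  s = proj₁ (P.to s)
      b  s = proj₁ (proj₁ (proj₂ (P.to s)))
      b′ s = proj₁ (proj₂ (proj₂ (P.to s)))
      height×b height×b′ : Fin (2 * ι) → ℕ × Cantor
      height×b  s = proj₁ (proj₁ (proj₂ (proj₁ (proj₂ (P.to s))))) , b s
      height×b′ s = proj₁ (proj₁ (proj₂ (proj₂ (proj₂ (P.to s))))) , b′ s
      z≡b+x : ∀ s → z s ≗ b s +ᶜ x
      z≡b+x s = proj₂ (proj₂ (proj₁ (proj₂ (P.to s))))
      z≡b′+y : ∀ s → z s ≗ b′ s +ᶜ y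
      z≡b′+y s = proj₂ (proj₂ (proj₂ (proj₂ (P.to s))))
      b+x≡b′+y : ∀ s → b s +ᶜ x ≗ b′ s +ᶜ y
      b+x≡b′+y s n = trans (sym (z≡b+x s n)) (z≡b′+y s n)
      b-inj : ∀ {s t} → b s ≗ b t → s ≡ t
      b-inj {s} {t} eq = P.injective λ n →
        trans (z≡b+x s n) (trans (cong (_xor x n) (eq n)) (sym (z≡b+x t n)))
      b′-inj : ∀ {s t} → b′ s ≗ b′ t → s ≡ t
      b′-inj {s} {t} eq = P.injective λ n →
        trans (z≡b′+y s n) (trans (cong (_xor y n) (eq n)) (sym (z≡b′+y t n)))
      _~_ : Fin (2 * ι) → Fin (2 * ι) → Set
      s ~ t = b s ≗ b′ t
      ~-sym : ∀ {s t} → s ~ t → t ~ s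
      ~-sym {s} {t} eq n = begin
        b t n                     ≡⟨ xor-cancelʳ (b t n) (x n) ⟨
        (b t n xor x n) xor x n   ≡⟨ cong (_xor x n) (b+x≡b′+y t n) ⟩
        (b′ t n xor y n) xor x n  ≡⟨ cong (λ c → (c xor y n) xor x n) (eq n) ⟨
        (b s n xor y n) xor x n   ≡⟨ xor-rightComm (b s n) (y n) (x n) ⟩
        (b s n xor x n) xor y n   ≡⟨ cong (_xor y n) (b+x≡b′+y s n) ⟩
        (b′ s n xor y n) xor y n  ≡⟨ xor-cancelʳ (b′ s n) (y n) ⟩
        b′ s n                    ∎
        where open ≡-Reasoning
      ~-irrefl : ∀ {s} → ¬ s ~ s
      ~-irrefl {s} eq = x≢y λ n → begin
        x n                      ≡⟨ xor-cancelˡ (b s n) (x n) ⟨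
        b s n xor (b s n xor x n)  ≡⟨ cong₂ _xor_ (eq n) (b+x≡b′+y s n) ⟩
        b′ s n xor (b′ s n xor y n) ≡⟨ xor-cancelˡ (b′ s n) (y n) ⟩
        y n                      ∎
        where open ≡-Reasoning
      chosen = independent _~_ ~-sym ~-irrefl
        (λ s~t s~t′ → b′-inj λ n → trans (sym (s~t n)) (s~t′ n))
        ι (ℕ.≤-reflexive (ℕ.*-comm ι 2)) id id
      q = proj₁ chosen
      q-inj = proj₁ (proj₂ chosen)
      q-indep = proj₁ (proj₂ (proj₂ chosen))
      shift-inj : Injective {A = Fin ι ⊎ Fin ι} _≡_ _≗_ [ b ∘ q , b′ ∘ q ]′
      shift-inj {inj₁ i} {inj₁ j} eq = cong inj₁ (q-inj (b-inj eq))
      shift-inj {inj₁ i} {inj₂ j} eq = contradiction eq (q-indep i j)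
      shift-inj {inj₂ i} {inj₁ j} eq = contradiction (λ n → sym (eq n)) (q-indep j i)
      shift-inj {inj₂ i} {inj₂ j} eq = cong inj₂ (q-inj (b′-inj eq))

-- Restrictions

Eventually : (ℕ → Set) → Set
Eventually P = ∃[ N ] ∀ ℓ → N ≤ ℓ → P ℓ

eventually-Fin : ∀ {k} {P : Fin k → ℕ → Set} →
                 (∀ j → Eventually (P j)) → Eventually (λ ℓ → ∀ j → P j ℓ)
eventually-Fin {zero}  ev = 0 , λ _ _ ()
eventually-Fin {suc k} ev with ev zero | eventually-Fin (ev ∘ suc)
... | M , p | N , q = M ⊔ N , λ where
  ℓ le zero    → p ℓ (ℕ.≤-trans (m≤m⊔n M N) le)
  ℓ le (suc j) → q ℓ (ℕ.≤-trans (m≤n⊔m M N) le) j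

eventually-× : ∀ {P Q} → Eventually P → Eventually Q → Eventually (λ ℓ → P ℓ × Q ℓ)
eventually-× (M , p) (N , q) = M ⊔ N , λ ℓ le →
  p ℓ (ℕ.≤-trans (m≤m⊔n M N) le) , q ℓ (ℕ.≤-trans (m≤n⊔m M N) le)

eventually-⊎ : ∀ {m n} {P : Fin m ⊎ Fin n → ℕ → Set} →
               (∀ s → Eventually (P s)) → Eventually (λ ℓ → ∀ s → P s ℓ)
eventually-⊎ ev with eventually-× (eventually-Fin (ev ∘ inj₁)) (eventually-Fin (ev ∘ inj₂))
... | N , p = N , λ where
  ℓ le (inj₁ i) → proj₁ (p ℓ le) i
  ℓ le (inj₂ i) → proj₂ (p ℓ le) i

↾-cong : ∀ {x y} ℓ → x ≗ y → x ↾ ℓ ≡ y ↾ ℓ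
↾-cong ℓ x≗y = tabulate-cong (x≗y ∘ toℕ)

↾-≡⇒≡ : ∀ x y {ℓ n} → x ↾ ℓ ≡ y ↾ ℓ → n < ℓ → x n ≡ y n
↾-≡⇒≡ x y {ℓ} {n} eq n<ℓ = begin
  x n                       ≡⟨ cong x (toℕ-fromℕ< n<ℓ) ⟨
  x (toℕ i)                 ≡⟨ lookup∘tabulate (x ∘ toℕ) i ⟨
  lookup (x ↾ ℓ) i          ≡⟨ cong (λ v → lookup v i) eq ⟩
  lookup (y ↾ ℓ) i          ≡⟨ lookup∘tabulate (y ∘ toℕ) i ⟩
  y (toℕ i)                 ≡⟨ cong y (toℕ-fromℕ< n<ℓ) ⟩
  y n                       ∎
  where
  open ≡-Reasoning
  i = fromℕ< n<ℓ

truncate-↾ : ∀ x {k ℓ} (k≤ℓ : k ≤ ℓ) → truncate k≤ℓ (x ↾ ℓ) ≡ x ↾ k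
truncate-↾ x z≤n       = refl
truncate-↾ x (s≤s k≤ℓ) = cong (x 0 ∷_) (truncate-↾ (x ∘ suc) k≤ℓ)

↾-⊕ : ∀ x y ℓ → (x ↾ ℓ) ⊕ (y ↾ ℓ) ≡ (x +ᶜ y) ↾ ℓ
↾-⊕ x y zero    = refl
↾-⊕ x y (suc ℓ) = cong ((x +ᶜ y) 0 ∷_) (↾-⊕ (x ∘ suc) (y ∘ suc) ℓ)

sums-↾ : ∀ x x′ y y′ {ℓ} {η ν : Vec Bool ℓ} → x ↾ ℓ ≡ η → y ↾ ℓ ≡ ν →
         x +ᶜ x′ ≗ y +ᶜ y′ → η ⊕ (x′ ↾ ℓ) ≡ ν ⊕ (y′ ↾ ℓ)
sums-↾ x x′ y y′ {ℓ} refl refl eq =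
  trans (↾-⊕ x x′ ℓ) (trans (↾-cong ℓ eq) (sym (↾-⊕ y y′ ℓ)))

2≤∣subset∣ : {X : Set} {P : Pred X 0ℓ} {x y : X} → x ∈ P → y ∈ P → x ≢ y →
             2 ≤∣ subset (setoid X) P ∣
2≤∣subset∣ {X} {P} {x} {y} x∈P y∈P x≢y = record
  { to        = to
  ; cong      = λ { refl → refl }
  ; injective = injective _ _
  }
  where
  to : Fin 2 → Σ X P
  to zero    = x , x∈P
  to (suc _) = y , y∈P
  injective : ∀ i j → proj₁ (to i) ≡ proj₁ (to j) → i ≡ j
  injective zero       zero       _  = refl
  injective zero       (suc zero) eq = contradiction eq x≢y
  injective (suc zero) zero       eq = contradiction (sym eq) x≢y
  injective (suc zero) (suc zero) _  = refl

∉⇒≢lookup : ∀ {X : Set} {n x} {xs : Vec X n} → x Mem.∉ xs → ∀ k → x ≢ lookup xs k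
∉⇒≢lookup {xs = xs} x∉xs k refl = x∉xs (∈-lookup k xs)

-- The vocabulary

pairing : ∀ {k} → Fin (suc k) × ℕ → ℕ
pairing {k} (i , n) = toℕ i + n * suc k

pairing-injective : ∀ {k} {p q : Fin (suc k) × ℕ} → pairing p ≡ pairing q → p ≡ q
pairing-injective {k} {i , m} {j , n} eq with Fin.toℕ-injective i≡j
  where
  remainder : ∀ (i : Fin (suc k)) n → pairing (i , n) % suc k ≡ toℕ i
  remainder i n = trans ([m+kn]%n≡m%n (toℕ i) n (suc k)) (m<n⇒m%n≡m (toℕ<n i))
  i≡j = trans (sym (remainder i m)) (trans (cong (_% suc k) eq) (remainder j n))
... | refl = cong (i ,_) (ℕ.*-cancelʳ-≡ m n (suc k) (ℕ.+-cancelˡ-≡ (toℕ i) _ _ eq))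

-- The n-th bit of η_a is coded by (point , n), that of g_i(a , b) by
-- (translate i , n), and h_i(a , b) = n by (level i , n).
Symbol : ℕ → Set
Symbol ι = Maybe (Fin ι ⊎ Fin ι) × ℕ

pattern point       = nothing
pattern translate i = just (inj₁ i)
pattern level i     = just (inj₂ i)

vocabulary : ℕ → Vocabulary
vocabulary ι = record { Fun = ⊥ ; Rl = Symbol ι ; arityᶠ = λ () ; arityʳ = λ _ → 2 }

vocabulary-countable : ∀ ι → CountableVocabulary (vocabulary ι)
vocabulary-countable ι =
    record { to = λ () ; cong = λ { {()} } ; injective = λ { {()} } }
  , record
    { to        = λ (κ , n) → pairing (kind κ , n)
    ; cong      = λ { refl → refl }
    ; injective = λ eq → let eq′ = pairing-injective eq
                         in cong₂ _,_ (kind-injective (cong proj₁ eq′)) (cong proj₂ eq′)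
    }
  where
  kind : Maybe (Fin ι ⊎ Fin ι) → Fin (suc (ι + ι))
  kind nothing  = zero
  kind (just s) = suc (join ι ι s)
  kind-injective : ∀ {κ κ′} → kind κ ≡ kind κ′ → κ ≡ κ′
  kind-injective {nothing} {nothing} _  = refl
  kind-injective {just s}  {just t}  eq = cong just
    (trans (sym (splitAt-join ι ι s))
      (trans (cong (splitAt ι) (Fin.suc-injective eq)) (splitAt-join ι ι t)))

module Coding
  (em : ExcludedMiddle (lsuc 0ℓ)) (T : ℕ → SeqSet) (ι : ℕ) {Λ : Set}
  (e : Λ → Cantor) (e-inj : ∀ {c d} → e c ≗ e d → c ≡ d)
  (h : Fin ι → Λ → Λ → ℕ) (g : Fin ι → Λ → Λ → Cantor)
  (g∈ : ∀ {c d} → c ≢ d → ∀ i → g i c d ∈ branches (T (h i c d)))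
  (g-sum : ∀ {c d} → c ≢ d → ∀ i → e c +ᶜ g i c d ≗ e d +ᶜ g i d c)
  (g-inj : ∀ {c d} → c ≢ d → Injective {A = Fin ι ⊎ Fin ι} _≡_ _≗_
             [ (λ i → g i c d) , (λ i → g i d c) ]′)
  where

  open Classical em
  open Choice em using (difference)

  eventually-separates : ∀ x y → Eventually (λ ℓ → x ↾ ℓ ≡ y ↾ ℓ → x ≗ y)
  eventually-separates x y with dec (x ≗ y)
  ... | yes x≗y = 0 , λ _ _ _ → x≗y
  ... | no  x≢y =
    let n , xn≢yn = difference x≢y
    in suc n , λ ℓ n<ℓ eq → contradiction (↾-≡⇒≡ x y eq n<ℓ) xn≢yn

  record Separates {n} (a : Vec Λ n) (ℓ : ℕ) : Set where
    field
      0<ℓ   : 0 < ℓ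
      e-sep : ∀ j k → e (lookup a j) ↾ ℓ ≡ e (lookup a k) ↾ ℓ → lookup a j ≡ lookup a k
      g-sep : ∀ j k → lookup a j ≢ lookup a k → Injective {A = Fin ι ⊎ Fin ι} _≡_ _≡_
        [ (λ i → g i (lookup a j) (lookup a k) ↾ ℓ)
        , (λ i → g i (lookup a k) (lookup a j) ↾ ℓ) ]′

  separating : ∀ {n} (a : Vec Λ n) → Eventually (Separates a)
  separating a =
    let N , sep = eventually-×
          (1 , λ ℓ 0<ℓ → 0<ℓ)
          (eventually-×
            (eventually-Fin λ j → eventually-Fin λ k →
              eventually-separates (e (lookup a j)) (e (lookup a k)))
            (eventually-Fin λ j → eventually-Fin λ k → eventually-⊎ λ s → eventually-⊎ λ t →
              eventually-separates (both j k s) (both j k t)))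
    in N , λ ℓ N≤ℓ → let 0<ℓ , e-sep , g-sep = sep ℓ N≤ℓ in record
      { 0<ℓ   = 0<ℓ
      ; e-sep = λ j k eq → e-inj (e-sep j k eq)
      ; g-sep = λ j k j≢k {s} {t} eq → g-inj j≢k (g-sep j k s t
          (trans ([,]-∘ (_↾ ℓ) s) (trans eq (sym ([,]-∘ (_↾ ℓ) t)))))
      }
    where
    both : ∀ j k → Fin ι ⊎ Fin ι → Cantor
    both j k = [ (λ i → g i (lookup a j) (lookup a k)) , (λ i → g i (lookup a k) (lookup a j)) ]′

  module _ {n} (a : Vec Λ (suc n)) {ℓ : ℕ} where

    Named : Vec Bool ℓ → Set
    Named σ = ∃[ j ] e (lookup a j) ↾ ℓ ≡ σ

    named : Level⊆ ℓ
    named σ = does (dec (Named σ))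

    named⇒Named : ∀ {σ} → σ ∈ᵇ named → Named σ
    named⇒Named {σ} p with dec (Named σ) | p
    ... | yes q | _ = q
    ... | no _  | ()

    Named⇒named : ∀ {σ} → Named σ → σ ∈ᵇ named
    Named⇒named {σ} p = dec-true (dec (Named σ)) p

    name : Vec Bool ℓ → Λ
    name σ with dec (Named σ)
    ... | yes (j , _) = lookup a j
    ... | no  _       = lookup a zero

    name-spec : ∀ {σ} → σ ∈ᵇ named → ∃[ j ] name σ ≡ lookup a j × e (name σ) ↾ ℓ ≡ σ
    name-spec {σ} p with dec (Named σ) | p
    ... | yes (j , q) | _ = j , refl , q
    ... | no _        | ()

    e-name : ∀ {σ} → σ ∈ᵇ named → e (name σ) ↾ ℓ ≡ σ
    e-name p = proj₂ (proj₂ (name-spec p))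

    name-unique : Separates a ℓ → ∀ {σ} j → e (lookup a j) ↾ ℓ ≡ σ → name σ ≡ lookup a j
    name-unique sep j eq with k , name≡ , e≡ ← name-spec (Named⇒named (j , eq)) =
      trans name≡ (e-sep k j (trans (cong (λ c → e c ↾ ℓ) (sym name≡)) (trans e≡ (sym eq))))
      where open Separates sep

    name-≢ : ∀ {η ν} → (named ⟨2⟩) η ν → name η ≢ name ν
    name-≢ (η∈ , ν∈ , η≢ν) eq =
      η≢ν (trans (sym (e-name η∈)) (trans (cong (λ c → e c ↾ ℓ) eq) (e-name ν∈)))

  𝐦 : ∀ {n} (a : Vec Λ (suc (suc n))) → lookup a zero ≢ lookup a (suc zero) →
      ∀ {ℓ} → Separates a ℓ → 𝐌 T ι
  𝐦 a a₀≢a₁ {ℓ} sep = record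
    { ℓ     = ℓ
    ; u     = named a
    ; h     = λ i η ν _ → h i (name a η) (name a ν)
    ; g     = λ i η ν _ → g i (name a η) (name a ν) ↾ ℓ
    ; 0<ℓ   = 0<ℓ
    ; 2≤∣u∣ = 2≤∣subset∣ (Named⇒named a (zero , refl)) (Named⇒named a (suc zero , refl))
                (a₀≢a₁ ∘ e-sep zero (suc zero))
    ; g∈T   = λ i p → g∈ (name-≢ a p) i ℓ
    ; g-sum = λ i {η} {ν} p@(η∈ , ν∈ , _) →
        sums-↾ (e (name a η)) (g i (name a η) (name a ν)) (e (name a ν)) (g i (name a ν) (name a η))
          (e-name a η∈) (e-name a ν∈) (g-sum (name-≢ a p) i)
    ; g-inj = λ {η} {ν} p {s} {t} → g-inj′ p {s} {t}
    }
    where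
    open Separates sep
    g-inj′ : ∀ {η ν} → (named a ⟨2⟩) η ν → Injective {A = Fin ι ⊎ Fin ι} _≡_ _≡_
      [ (λ i → g i (name a η) (name a ν) ↾ ℓ) , (λ i → g i (name a ν) (name a η) ↾ ℓ) ]′
    g-inj′ p@(η∈ , ν∈ , _) with name-≢ a p | name-spec a η∈ | name-spec a ν∈
    ... | η≢ν | j , eq , _ | k , eq′ , _ rewrite eq | eq′ = g-sep j k η≢ν

  holds : Symbol ι → Λ → Λ → Set
  holds (point , n)       c d = e c n ≡ true
  holds (translate i , n) c d = g i c d n ≡ true
  holds (level i , n)     c d = h i c d ≡ n

  model : Model (vocabulary ι) Λ
  model = record
    { funᴵ = λ ()
    ; relᴵ = λ { s (c ∷ d ∷ []) → holds s c d }
    }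

  module _ {n} (a : Vec Λ (suc n)) where

    Forced : Pred (Vec Λ (suc n)) 0ℓ → Set
    Forced P = ∃[ φ ] ⊨_[_] model φ a × (∀ a′ → ⊨_[_] model φ a′ → P a′)

    forced-map : ∀ {P Q : Pred (Vec Λ (suc n)) 0ℓ} → (∀ {a′} → P a′ → Q a′) → Forced P → Forced Q
    forced-map P⇒Q (φ , ⊨φ , forces) = φ , ⊨φ , λ a′ ⊨φ′ → P⇒Q (forces a′ ⊨φ′)

    forced-× : ∀ {P Q : Pred (Vec Λ (suc n)) 0ℓ} → Forced P → Forced Q →
               Forced (λ a′ → P a′ × Q a′)
    forced-× (φ , ⊨φ , p) (ψ , ⊨ψ , q) =
      φ ∧ ψ , (⊨φ , ⊨ψ) , λ a′ (⊨φ′ , ⊨ψ′) → p a′ ⊨φ′ , q a′ ⊨ψ′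

    forced-Fin : ∀ {k} {P : Fin k → Pred (Vec Λ (suc n)) 0ℓ} →
                 (∀ j → Forced (P j)) → Forced (λ a′ → ∀ j → P j a′)
    forced-Fin {zero}  fs = var zero ≐ var zero , refl , λ _ _ ()
    forced-Fin {suc k} fs = forced-map (λ { (p , q) zero → p ; (p , q) (suc j) → q j })
      (forced-× (fs zero) (forced-Fin (fs ∘ suc)))

    literal : Symbol ι → Fin (suc n) → Fin (suc n) → QF (vocabulary ι) (suc n)
    literal s j k = rel s (var j ∷ var k ∷ [])

    forced-bit : ∀ s (x : Λ → Λ → Bool) → (∀ c d → holds s c d ≡ (x c d ≡ true)) → ∀ j k →
      Forced (λ a′ → x (lookup a′ j) (lookup a′ k) ≡ x (lookup a j) (lookup a k))
    forced-bit s x holds≡ j k with x (lookup a j) (lookup a k) in eq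
    ... | true  = literal s j k , subst id (sym (holds≡ _ _)) eq , λ a′ → subst id (holds≡ _ _)
    ... | false = neg (literal s j k)
      , (λ p → contradiction (trans (sym eq) (subst id (holds≡ _ _) p)) λ ())
      , λ a′ ¬p → ¬-not λ q → ¬p (subst id (sym (holds≡ _ _)) q)

    record SameType (ℓ : ℕ) (a′ : Vec Λ (suc n)) : Set where
      field
        e-same : ∀ j → e (lookup a′ j) ↾ ℓ ≡ e (lookup a j) ↾ ℓ
        h-same : ∀ i j k → h i (lookup a′ j) (lookup a′ k) ≡ h i (lookup a j) (lookup a k)
        g-same : ∀ i j k → g i (lookup a′ j) (lookup a′ k) ↾ ℓ ≡ g i (lookup a j) (lookup a k) ↾ ℓ

    forced-type : ∀ ℓ → Forced (SameType ℓ)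
    forced-type ℓ = forced-map
      (λ (p , q , r) → record
        { e-same = λ j → tabulate-cong (p j)
        ; h-same = q
        ; g-same = λ i j k → tabulate-cong (r i j k)
        })
      (forced-×
        (forced-Fin λ j → forced-Fin λ (m : Fin ℓ) →
          forced-bit (point , toℕ m) (λ c _ → e c (toℕ m)) (λ _ _ → refl) j j)
        (forced-×
          (forced-Fin λ i → forced-Fin λ j → forced-Fin λ k →
            literal (level i , h i (lookup a j) (lookup a k)) j k , refl , λ _ → id)
          (forced-Fin λ i → forced-Fin λ j → forced-Fin λ k → forced-Fin λ (m : Fin ℓ) →
            forced-bit (translate i , toℕ m) (λ c d → g i c d (toℕ m)) (λ _ _ → refl) j k)))

  -- Adding to a a further point b of the type of a_j over the other entries
  -- duplicates the node η_{a_j} ↾ ℓ and otherwise extends 𝐦 a.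
  module _ {n} (a : Vec Λ (suc (suc n))) {ℓ} (j : Fin (suc (suc n))) (b : Λ)
           (same : SameType a ℓ (a [ j ]≔ b)) where

    open SameType same

    origin : Fin (suc (suc (suc n))) → Fin (suc (suc n))
    origin zero    = j
    origin (suc k) = k

    e-origin : ∀ s → e (lookup (b ∷ a) s) ↾ ℓ ≡ e (lookup a (origin s)) ↾ ℓ
    e-origin (suc k) = refl
    e-origin zero    = trans (cong (λ c → e c ↾ ℓ) (sym (lookup∘update j a b))) (e-same j)

    hg-origin : ∀ i s t → e (lookup (b ∷ a) s) ↾ ℓ ≢ e (lookup (b ∷ a) t) ↾ ℓ →
      h i (lookup (b ∷ a) s) (lookup (b ∷ a) t) ≡ h i (lookup a (origin s)) (lookup a (origin t)) ×
      g i (lookup (b ∷ a) s) (lookup (b ∷ a) t) ↾ ℓ ≡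
        g i (lookup a (origin s)) (lookup a (origin t)) ↾ ℓ
    hg-origin i zero zero       b≢b = contradiction refl b≢b
    hg-origin i (suc k) (suc l) _   = refl , refl
    hg-origin i zero (suc k) b≢aₖ with j Fin.≟ k
    ... | yes refl = contradiction (e-origin zero) b≢aₖ
    ... | no  j≢k  =
      subst (λ (c , d) → h i c d ≡ _ × g i c d ↾ ℓ ≡ _)
        (cong₂ _,_ (lookup∘update j a b) (lookup∘update′ (j≢k ∘ sym) a b))
        (h-same i j k , g-same i j k)
    hg-origin i (suc k) zero aₖ≢b with j Fin.≟ k
    ... | yes refl = contradiction (sym (e-origin zero)) aₖ≢b
    ... | no  j≢k  =
      subst (λ (c , d) → h i c d ≡ _ × g i c d ↾ ℓ ≡ _)
        (cong₂ _,_ (lookup∘update′ (j≢k ∘ sym) a b) (lookup∘update j a b))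
        (h-same i k j , g-same i k j)

    𝐦-⊑ : ∀ a₀≢a₁ (sep : Separates a ℓ) {ℓ′} b≢a₀ (sep′ : Separates (b ∷ a) ℓ′) → ℓ ≤ ℓ′ →
          𝐦 a a₀≢a₁ sep ⊑ 𝐦 (b ∷ a) b≢a₀ sep′
    𝐦-⊑ _ sep {ℓ′} _ sep′ ℓ≤ℓ′ = record
      { ℓ≤   = ℓ≤ℓ′
      ; u-eq = λ σ → mk⇔
          (λ σ∈ → let k , eq = named⇒Named a σ∈ in
            e (lookup a k) ↾ ℓ′ , Named⇒named (b ∷ a) (suc k , refl) ,
            trans (truncate-↾ (e (lookup a k)) ℓ≤ℓ′) eq)
          (λ (η , η∈ , eq) → let s , eq′ = named⇒Named (b ∷ a) η∈ in
            Named⇒named a (origin s ,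
              trans (sym (e-origin s)) (trans (sym (truncate-↾ (e (lookup (b ∷ a) s)) ℓ≤ℓ′))
                (trans (cong (truncate ℓ≤ℓ′) eq′) eq))))
      ; h-eq = λ i p q → sym (proj₁ (compare i p q))
      ; g-eq = λ i {η} {ν} p q → sym (trans
          (truncate-↾ (g i (name (b ∷ a) η) (name (b ∷ a) ν)) ℓ≤ℓ′) (proj₂ (compare i p q)))
      }
      where
      π = truncate ℓ≤ℓ′
      traced : ∀ {η} → η ∈ᵇ named (b ∷ a) → ∃[ s ]
        name (b ∷ a) η ≡ lookup (b ∷ a) s × name a (π η) ≡ lookup a (origin s) ×
        e (lookup (b ∷ a) s) ↾ ℓ ≡ π η
      traced {η} η∈ with s , eq , eq′ ← name-spec (b ∷ a) η∈ =
        s , eq , name-unique a sep (origin s) (trans (sym (e-origin s)) πη) , πη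
        where
        πη : e (lookup (b ∷ a) s) ↾ ℓ ≡ π η
        πη = trans (sym (truncate-↾ (e (lookup (b ∷ a) s)) ℓ≤ℓ′))
               (cong π (trans (cong (λ c → e c ↾ ℓ′) (sym eq)) eq′))
      compare : ∀ i {η ν} → (named (b ∷ a) ⟨2⟩) η ν → (named a ⟨2⟩) (π η) (π ν) →
        h i (name (b ∷ a) η) (name (b ∷ a) ν) ≡ h i (name a (π η)) (name a (π ν)) ×
        g i (name (b ∷ a) η) (name (b ∷ a) ν) ↾ ℓ ≡ g i (name a (π η)) (name a (π ν)) ↾ ℓ
      compare i (η∈ , ν∈ , _) (_ , _ , πη≢πν) with traced η∈ | traced ν∈
      ... | s , eqs , eqs′ , es | t , eqt , eqt′ , et rewrite eqs | eqs′ | eqt | eqt′ =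
        hg-origin i s t λ eq → πη≢πν (trans (sym es) (trans eq et))

  rk≥⇒ndrk≥ : ∀ α {n} (a : Vec Λ (suc (suc n))) (a₀≢a₁ : lookup a zero ≢ lookup a (suc zero))
              {ℓ} (sep : Separates a ℓ) → _rk≥_ model a α → 𝐦 a a₀≢a₁ sep ndrk≥ α
  rk≥⇒ndrk≥ zero        a a₀≢a₁ sep _ = tt
  rk≥⇒ndrk≥ (lim I _ f) a a₀≢a₁ sep r = λ i → rk≥⇒ndrk≥ (f i) a a₀≢a₁ sep (r i)
  rk≥⇒ndrk≥ (suc α)     a a₀≢a₁ {ℓ} sep r ν ν∈ =
    let j , ν≡                 = named⇒Named a ν∈
        φ , ⊨φ , forces        = forced-type a ℓ
        b , b∉a , r′ , ⊨φb     = r φ j ⊨φ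
        same                   = forces (a [ j ]≔ b) ⊨φb
        N , separates          = separating (b ∷ a)
        ℓ′                     = suc ℓ ⊔ N
        ℓ<ℓ′                   = m≤m⊔n (suc ℓ) N
        sep′                   = separates ℓ′ (m≤n⊔m (suc ℓ) N)
        b≢                     = ∉⇒≢lookup b∉a
        ◁e : ∀ s → e (lookup (b ∷ a) s) ↾ ℓ ≡ ν → ν ◁ (e (lookup (b ∷ a) s) ↾ ℓ′)
        ◁e s eq                = ℓ<ℓ′ , trans (truncate-↾ (e (lookup (b ∷ a) s)) (<⇒≤ ℓ<ℓ′)) eq
    in 𝐦 (b ∷ a) (b≢ zero) sep′ , ℓ<ℓ′ , 𝐦-⊑ a j b same a₀≢a₁ sep (b≢ zero) sep′ (<⇒≤ ℓ<ℓ′) ,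
       rk≥⇒ndrk≥ α (b ∷ a) (b≢ zero) sep′ r′ ,
       2≤∣subset∣
         (Named⇒named (b ∷ a) (zero , refl) , ◁e zero (trans (e-origin a j b same zero) ν≡))
         (Named⇒named (b ∷ a) (suc j , refl) , ◁e (suc j) ν≡)
         (b≢ j ∘ Separates.e-sep sep′ zero (suc j))

  ¬rk≥suc : ∀ σ → (∀ (𝐦 : 𝐌 T ι) → ¬ 𝐦 ndrk≥ σ) →
            ∀ {n} (a : Vec Λ (suc n)) → ¬ _rk≥_ model a (suc σ)
  ¬rk≥suc σ ¬ndrk≥σ a r =
    let b , b∉a , r′ , _ = r (var zero ≐ var zero) zero refl
        b≢a₀             = ∉⇒≢lookup b∉a zero
        N , separates    = separating (b ∷ a)
        sep              = separates N ℕ.≤-refl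
    in ¬ndrk≥σ (𝐦 (b ∷ a) b≢a₀ sep) (rk≥⇒ndrk≥ σ (b ∷ a) b≢a₀ sep r′)

  NPr-bounded : ∀ {σ ε} → (∀ (𝐦 : 𝐌 T ι) → ¬ 𝐦 ndrk≥ σ) → σ <ᵒ ε → NPr ε Λ
  NPr-bounded {σ} {ε} ¬ndrk≥σ σ<ε =
    let s , upper , least = sup± (λ ((_ , a , _) : ∃₂ λ n (a : Vec Λ (suc n)) → Unique a) →
                                    proj₁ (rk-exists model a))
    in vocabulary ι , model , vocabulary-countable ι , s
     , ((λ r (n , a , uniq , p) →
           ≤±-trans (λ {α} {β} {γ} → ≤-trans α β γ)
             (rk-unique p (proj₂ (rk-exists model a))) (upper (n , a , uniq)))
       , λ t ub → least t λ (n , a , uniq) → ub _ (n , a , uniq , proj₂ (rk-exists model a)))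
     , <±-transʳ (λ {α} {β} {γ} → ≤-<-trans α β γ)
         (least Ext.[ σ ] λ (n , a , _) → bounded a (proj₂ (rk-exists model a))) <±[ σ<ε ]
    where
    bounded : ∀ {n} (a : Vec Λ (suc n)) {r} → rk_≐_ model a r → r ≤± Ext.[ σ ]
    bounded a (minusOne _) = ⊥±≤ _
    bounded a (infinite r) = contradiction (r (suc σ)) (¬rk≥suc σ ¬ndrk≥σ a)
    bounded a (ordinal {α} r _) with ≤ᵒ-or-> α σ
    ... | inj₁ α≤σ = ±[ α≤σ ]
    ... | inj₂ σ<α = contradiction (rk≥-antimono model (suc σ) α a σ<α r) (¬rk≥suc σ ¬ndrk≥σ a)

corollary3p12 : ExcludedMiddle (lsuc 0ℓ) →
    (T : ℕ → SeqSet) → (∀ n → IsTree (T n)) → (∀ n → NoMaximalNodes (T n)) →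
    (ι : ℕ) → 2 ≤ ι →
    (ε : Ord) → ε ≤ᵒ ω₁ →
    (Λ : Set) → Uncountable (setoid Λ) → Pr ε Λ →
    (A : Pred Cantor 0ℓ) → Bijection (setoid Λ) (subset CantorSetoid A) →
    (∀ η ν → η ∈ A → ν ∈ A →
    2 * ι ≤∣ subset CantorSetoid ((⋃branches T +ˢ η) ∩ (⋃branches T +ˢ ν)) ∣) →
    NDRK T , ι ≥ ε
corollary3p12 em T _ _ ι _ ε _ Λ _ pr A Λ⤖A hyp = conclude (NDRK-exists T ι)
  where
  open Classical em
  open Choice em
  module E = Bijection Λ⤖A

  e : Λ → Cantor
  e c = proj₁ (E.to c)

  overlapping : ∀ {c d} → Precedes (e c) (e d) →
                ∃₂ λ (f f′ : Fin ι → ℕ × Cantor) → Overlap T (e c) (e d) f f′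
  overlapping {c} {d} (n , _ , cn , dn) = translates-overlap
    (λ e≗ → contradiction (trans (sym cn) (trans (e≗ n) dn)) λ ())
    (hyp (e c) (e d) (proj₂ (E.to c)) (proj₂ (E.to d)))

  -- Condition (iv) relates the choices for (c , d) and for (d , c), so one
  -- choice is made for both, at the lexicographically increasing pair.
  hg : ∀ {c d} → Dec (Precedes (e c) (e d)) → Dec (Precedes (e d) (e c)) → Fin ι → ℕ × Cantor
  hg (yes c<d) _         = proj₁ (overlapping c<d)
  hg (no _)    (yes d<c) = proj₁ (proj₂ (overlapping d<c))
  hg (no _)    (no _)    = λ _ → 0 , λ _ → false

  hg-overlap : ∀ {c d} → c ≢ d → (p : Dec (Precedes (e c) (e d)))
               (q : Dec (Precedes (e d) (e c))) →
               Overlap T (e c) (e d) (hg p q) (hg q p)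
  hg-overlap c≢d (yes c<d) (yes d<c) = contradiction d<c (Precedes-asym c<d)
  hg-overlap c≢d (yes c<d) (no _)    = proj₂ (proj₂ (overlapping c<d))
  hg-overlap c≢d (no _)    (yes d<c) = flip (proj₂ (proj₂ (overlapping d<c)))
  hg-overlap c≢d (no c≮d)  (no d≮c)  with Precedes-total (c≢d ∘ E.injective)
  ... | inj₁ c<d = contradiction c<d c≮d
  ... | inj₂ d<c = contradiction d<c d≮c

  hg₂ : Fin ι → Λ → Λ → ℕ × Cantor
  hg₂ i c d = hg (dec (Precedes (e c) (e d))) (dec (Precedes (e d) (e c))) i

  module O {c d} (c≢d : c ≢ d) = Overlap (hg-overlap c≢d (dec _) (dec _))

  open Coding em T ι e E.injective
    (λ i c d → proj₁ (hg₂ i c d)) (λ i c d → proj₂ (hg₂ i c d))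
    (λ c≢d → O.shift∈ c≢d) (λ c≢d → O.shift-sum c≢d) (λ c≢d → O.shift-inj c≢d)

  supremum-unattained : ∀ {σ} → NDRK T , ι ≐ Sup.[ σ ] → ∀ (𝐦 : 𝐌 T ι) → ¬ 𝐦 ndrk≥ σ
  supremum-unattained {σ} (upper , _) 𝐦 r
    with r′ , p ← ndrk-exists 𝐦
    with p | upper _ (𝐦 , r′ , p , refl)
  ... | ordinal {β} _ ¬q | ⁺[ β<σ ] = ¬q (ndrk≥-antimono (suc β) σ β<σ r)

  conclude : ∃[ s ] NDRK T , ι ≐ s → NDRK T , ι ≥ ε
  conclude (⊤⁺        , p) = ⊤⁺ , p , (_ ≤⊤⁺)
  conclude (Sup.[ σ ] , p) with ≤ᵒ-or-> ε σ
  ... | inj₁ ε≤σ = Sup.[ σ ] , p , ⁺[ ε≤σ ]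
  ... | inj₂ σ<ε = contradiction (NPr-bounded (supremum-unattained p) σ<ε) pr
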